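{- For all positive integers $m,n$, the domination polynomial of the lollipop graph $L_{m,n}$ is unimodal.
   Context: For a finite simple graph $G$ on $n$ vertices, a set $U \subseteq V(G)$ is dominating if every vertex is in $U$ or adjacent to a vertex of $U$; $d_i(G)$ is the number of dominating sets of size $i$ and $D(G,x)=\sum_{i} d_i(G)x^i$ is the domination polynomial. A polynomial is unimodal if its coefficients (ordered by increasing power of $x$) are non-decreasing and then non-increasing. The $(m,n)$-lollipop graph $L_{m,n}$ is the graph on $m+n$ vertices consisting of a complete graph on $m$ vertices and a path on $n$ vertices, with one leaf (endpoint) of the path joined by an edge to a vertex of the complete graph. -}

module Defs where

open import Data.Bool using (Bool; true; false; _∧_; _∨_; not)
open import Data.Nat using (ℕ; zero; suc; _+_; _≤_; _<ᵇ_; _≡ᵇ_)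
open import Data.Fin using (Fin; toℕ)
open import Data.Fin.Subset using (Subset; ∣_∣)
open import Data.Vec using (Vec; []; _∷_; lookup)
open import Data.List using (List; []; _∷_; map; _++_; filter; length)
open import Data.Bool.ListAction using (any; all)
open import Data.List using () renaming (allFin to allFinL)
open import Data.Product using (∃; _×_)
open import Relation.Nullary.Decidable using (yes; no)
open import Relation.Binary.PropositionalEquality using (_≡_)
open import Data.Bool using (T?)

Adjacency : ℕ → Set
Adjacency N = Fin N → Fin N → Bool

allSubsets : (N : ℕ) → List (Subset N)
allSubsets zero = [] ∷ []
allSubsets (suc N) = map (true ∷_) (allSubsets N) ++ map (false ∷_) (allSubsets N)

isDominating : {N : ℕ} → Adjacency N → Subset N → Bool
isDominating {N} adj U =
  all (λ v → lookup U v ∨ any (λ u → lookup U u ∧ adj u v) (allFinL N)) (allFinL N)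

domCoeff : {N : ℕ} → Adjacency N → ℕ → ℕ
domCoeff {N} adj i =
  length (filter (λ U → T? (isDominating adj U ∧ (∣ U ∣ ≡ᵇ i))) (allSubsets N))

-- The domination polynomial D(G,x) = Σ_i d_i(G) x^i is represented by its
-- coefficient sequence i ↦ d_i(G) (zero for i > N).
dominationPoly : {N : ℕ} → Adjacency N → (ℕ → ℕ)
dominationPoly = domCoeff

Unimodal : (ℕ → ℕ) → Set
Unimodal a = ∃ λ k →
  (∀ i j → i ≤ j → j ≤ k → a i ≤ a j) ×
  (∀ i j → k ≤ i → i ≤ j → a j ≤ a i)

-- Lollipop graph L_{m,n} on Fin (m + n):
-- vertices 0..m-1 form the complete graph K_m, vertices m..m+n-1 form the path
-- P_n (in order), and the path leaf m is joined to the clique vertex m-1.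
lollipopAdj : (m n : ℕ) → Adjacency (m + n)
lollipopAdj m n i j =
  ((toℕ i <ᵇ m) ∧ (toℕ j <ᵇ m) ∧ not (toℕ i ≡ᵇ toℕ j))
  ∨ ((suc (toℕ i) ≡ᵇ toℕ j) ∧ not (toℕ j <ᵇ m))
  ∨ ((suc (toℕ j) ≡ᵇ toℕ i) ∧ not (toℕ i <ᵇ m))

{-# OPTIONS --safe #-}
module Submission where

-- Let c and p be the generating polynomials of the subsets of the path on n vertices that
-- dominate it with, respectively without, an extra chosen vertex attached in front. Fixing
-- the power k of x and letting n vary, the coefficients of c form the row (1 + t)(t + t² + t³)ᵏ,
-- and those of p the row (t + t²)(1 + t)(t + t² + t³)ᵏ⁻¹. Products of these factors are
-- log-concave, and this translates at fixed n into likelihood-ratio inequalities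
-- c ≼ xᵈ c, c ≼ xᵈ p, p ≼ xᵈ p, p ≼ xᵈ⁺¹ c. For m = M + 1 ≥ 2 the domination polynomial is x G with
-- G = Σ_j xʲ (C(M,j) c + C(M,j+1) p), that is G = Σ_l C(M,⌈l/2⌉) z_l for the sequence
-- z = (c, p, x c, x p, x² c, …), which is increasing for ≼. As C(M,·) is log-concave, the
-- Cauchy–Binet formula makes all minors of G ≼ x G non-negative: G is log-concave without
-- internal zeros, hence unimodal. For m = 1 the graph is a path.

open import Data.Bool using (Bool; true; false; T; T?; _∧_; _∨_; not; if_then_else_)
open import Data.Bool.ListAction using (any)
open import Data.Bool.Properties using (T-∧; T-∨)
open import Data.Empty using (⊥-elim)
open import Data.Fin using (Fin; toℕ; fromℕ<)
open import Data.Fin.Properties using (toℕ-fromℕ<; toℕ<n)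
open import Data.Fin.Subset using (Subset; ∣_∣)
open import Data.List using ([]; _∷_; map; filter; length; allFin)
open import Data.List.Membership.Propositional.Properties using (∈-allFin)
open import Data.List.Properties using (filter-++; length-++)
open import Data.List.Relation.Unary.All as All using ()
open import Data.List.Relation.Unary.All.Properties using (all⁺; all⁻)
open import Data.List.Relation.Unary.Any using (satisfied)
open import Data.List.Membership.Propositional using (lose)
open import Data.List.Relation.Unary.Any.Properties using (any⁺; any⁻)
open import Data.Nat using (ℕ; zero; suc; _+_; _*_; _≤_; _<_; _≤?_; _≟_; _≡ᵇ_; _<ᵇ_; z≤n; s≤s; ⌈_/2⌉)
open import Data.Nat.Properties
open import Data.Nat.Tactic.RingSolver using (solve-∀)
open import Data.Product using (∃; _×_; _,_; proj₁; proj₂)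
open import Data.Sum using (_⊎_; inj₁; inj₂)
open import Data.Vec using ([]; _∷_; lookup)
open import Defs
open import Function using (_∘_; Equivalence)
open import Relation.Nullary using (¬_; yes; no; contradiction)
open import Relation.Binary.PropositionalEquality
  using (_≡_; _≢_; _≗_; refl; sym; trans; cong; cong₂; subst; subst₂)

-- Sequences and the likelihood-ratio order

Seq : Set
Seq = ℕ → ℕ

infixl 6 _⊕_
infix 4 _≼_

_⊕_ : Seq → Seq → Seq
(f ⊕ g) n = f n + g n

shift : Seq → Seq
shift f zero = 0
shift f (suc n) = f n

shiftBy : ℕ → Seq → Seq
shiftBy zero f = f
shiftBy (suc d) f = shift (shiftBy d f)

δ : Seq
δ zero = 1
δ (suc n) = 0

-- Monotone likelihood ratio: g / f is non-decreasing, with denominators cleared.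
-- Because of zeros this is not transitive.
record _≼_ (f g : Seq) : Set where
  field
    minor : ∀ {a b} → a ≤ b → f b * g a ≤ f a * g b

open _≼_

-- Log-concavity without internal zeros.
PF₂ : Seq → Set
PF₂ f = ∀ d → f ≼ shiftBy d f

shift-cong : ∀ {f g} → f ≗ g → shift f ≗ shift g
shift-cong f≗g zero = refl
shift-cong f≗g (suc n) = f≗g n

shiftBy-cong : ∀ d {f g} → f ≗ g → shiftBy d f ≗ shiftBy d g
shiftBy-cong zero f≗g = f≗g
shiftBy-cong (suc d) f≗g = shift-cong (shiftBy-cong d f≗g)

shift-⊕ : ∀ f g → shift (f ⊕ g) ≗ shift f ⊕ shift g
shift-⊕ f g zero = refl
shift-⊕ f g (suc n) = refl

shiftBy-⊕ : ∀ d f g → shiftBy d (f ⊕ g) ≗ shiftBy d f ⊕ shiftBy d g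
shiftBy-⊕ zero f g n = refl
shiftBy-⊕ (suc d) f g n =
  trans (shift-cong (shiftBy-⊕ d f g) n) (shift-⊕ (shiftBy d f) (shiftBy d g) n)

shiftBy-shift : ∀ d f → shiftBy d (shift f) ≗ shift (shiftBy d f)
shiftBy-shift zero f n = refl
shiftBy-shift (suc d) f n = shift-cong (shiftBy-shift d f) n

≼-refl : ∀ {f} → f ≼ f
≼-refl {f} .minor {a} {b} _ = ≤-reflexive (*-comm (f b) (f a))

≼-resp : ∀ {f f′ g g′} → f ≗ f′ → g ≗ g′ → f ≼ g → f′ ≼ g′
≼-resp f≗f′ g≗g′ f≼g .minor {a} {b} a≤b =
  subst₂ _≤_ (cong₂ _*_ (f≗f′ b) (g≗g′ a)) (cong₂ _*_ (f≗f′ a) (g≗g′ b)) (f≼g .minor a≤b)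

≼-⊕ʳ : ∀ {f g h} → f ≼ g → f ≼ h → f ≼ g ⊕ h
≼-⊕ʳ {f} {g} {h} f≼g f≼h .minor {a} {b} a≤b =
  subst₂ _≤_ (sym (*-distribˡ-+ (f b) (g a) (h a))) (sym (*-distribˡ-+ (f a) (g b) (h b)))
    (+-mono-≤ (f≼g .minor a≤b) (f≼h .minor a≤b))

≼-⊕ˡ : ∀ {f g h} → f ≼ h → g ≼ h → f ⊕ g ≼ h
≼-⊕ˡ {f} {g} {h} f≼h g≼h .minor {a} {b} a≤b =
  subst₂ _≤_ (sym (*-distribʳ-+ (h a) (f b) (g b))) (sym (*-distribʳ-+ (h b) (f a) (g a)))
    (+-mono-≤ (f≼h .minor a≤b) (g≼h .minor a≤b))

shift-mono-≼ : ∀ {f g} → f ≼ g → shift f ≼ shift g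
shift-mono-≼ _ .minor {b = zero} z≤n = z≤n
shift-mono-≼ {f} _ .minor {b = suc b} z≤n = ≤-reflexive (*-zeroʳ (f b))
shift-mono-≼ f≼g .minor (s≤s a≤b) = f≼g .minor a≤b

shiftBy-mono-≼ : ∀ d {f g} → f ≼ g → shiftBy d f ≼ shiftBy d g
shiftBy-mono-≼ zero f≼g = f≼g
shiftBy-mono-≼ (suc d) f≼g = shift-mono-≼ (shiftBy-mono-≼ d f≼g)

-- If the smaller position is below `d`, the shifted sequence vanishes there and the minor is
-- trivial; otherwise `d` is subtracted from both positions.
≼-shiftBy : ∀ d {f g} → (∀ {a b} → a ≤ b → f (d + b) * g a ≤ f (d + a) * g b) → f ≼ shiftBy d g
≼-shiftBy zero h .minor a≤b = h a≤b
≼-shiftBy (suc d) {f} h .minor {b = b} z≤n = ≤-trans (≤-reflexive (*-zeroʳ (f b))) z≤n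
≼-shiftBy (suc d) {f} h .minor (s≤s a≤b) = ≼-shiftBy d {f ∘ suc} h .minor a≤b

-- Lowering `m` by `s` keeps it below `n`, so this is again a minor of `f ≼ g`; for `m < s` the left
-- side is zero.
≼-lag : ∀ {f g} → f ≼ g → ∀ s {m n} → m ≤ n → shiftBy s g m * f n ≤ shiftBy s f m * g n
≼-lag {f} {g} f≼g zero {m} {n} m≤n =
  ≤-trans (≤-reflexive (*-comm (g m) (f n))) (f≼g .minor m≤n)
≼-lag f≼g (suc s) {zero} m≤n = z≤n
≼-lag f≼g (suc s) {suc m} m<n = ≼-lag f≼g s (≤-trans (n≤1+n m) m<n)

-- Only zeros of the middle sequence obstruct transitivity. If `f b` and `h a` are non-zero, then so
-- is `g a` because `h ≤ g`, hence also `g b` by the minor of `f ≼ g`. The product of both minors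
-- can then be divided by `g a * g b`.
≼-trans : ∀ {f g h} → (∀ n → h n ≤ g n) → f ≼ g → g ≼ h → f ≼ h
≼-trans {f} {g} {h} h≤g f≼g g≼h .minor {a} {b} a≤b
  with f b | h a | h≤g a | f≼g .minor a≤b | g≼h .minor a≤b
... | zero | _ | _ | _ | _ = z≤n
... | suc u | zero | _ | _ | _ = ≤-trans (≤-reflexive (*-zeroʳ u)) z≤n
... | suc u | suc w | w<v | p | q with g a | g b
...   | suc v | zero = contradiction (≤-trans p (≤-reflexive (*-zeroʳ (f a)))) λ ()
...   | suc v | suc v′ = *-cancelʳ-≤ _ _ (suc v * suc v′) (subst₂ _≤_
        (rearrangeˡ (suc u) (suc w) (suc v) (suc v′)) (rearrangeʳ (f a) (h b) (suc v) (suc v′))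
        (*-mono-≤ p q))
  where
  rearrangeˡ : ∀ u w v v′ → (u * v) * (v′ * w) ≡ (u * w) * (v * v′)
  rearrangeˡ = solve-∀
  rearrangeʳ : ∀ u w v v′ → (u * v′) * (v * w) ≡ (u * w) * (v * v′)
  rearrangeʳ = solve-∀

PF₂-resp : ∀ {f g} → f ≗ g → PF₂ f → PF₂ g
PF₂-resp f≗g pf d = ≼-resp f≗g (shiftBy-cong d f≗g) (pf d)

δ-PF₂ : PF₂ δ
δ-PF₂ zero = ≼-refl {δ}
δ-PF₂ (suc d) .minor {b = b} z≤n = ≤-trans (≤-reflexive (*-zeroʳ (δ b))) z≤n
δ-PF₂ (suc d) .minor (s≤s _) = z≤n

PF₂-shift : ∀ {f} → PF₂ f → PF₂ (shift f)
PF₂-shift {f} pf d =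
  ≼-resp (λ _ → refl) (λ n → sym (shiftBy-shift d f n)) (shift-mono-≼ (pf d))

-- After a positive shift, every summand on the right is shifted at least as far as every summand on
-- the left, so all pairs are comparable.
PF₂-1+t : ∀ {f} → PF₂ f → PF₂ (f ⊕ shift f)
PF₂-1+t {f} pf zero = ≼-refl {f ⊕ shift f}
PF₂-1+t {f} pf (suc d) = ≼-resp (λ _ → refl)
  (λ n → sym (trans (shiftBy-⊕ (suc d) f (shift f) n)
                    (cong (shiftBy (suc d) f n +_) (shiftBy-shift (suc d) f n))))
  (≼-⊕ʳ {f ⊕ shift f} {shiftBy (suc d) f} {shiftBy (2 + d) f}
    (≼-⊕ˡ {f} {shift f} (pf (suc d)) (shift-mono-≼ (pf d)))
    (≼-⊕ˡ {f} {shift f} (pf (2 + d)) (shift-mono-≼ (pf (suc d)))))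

window : Seq → Seq
window f = f ⊕ shift f ⊕ shiftBy 2 f

shiftBy-window : ∀ d f → shiftBy d (window f) ≗ shiftBy d f ⊕ shiftBy (1 + d) f ⊕ shiftBy (2 + d) f
shiftBy-window d f n = trans (shiftBy-⊕ d (f ⊕ shift f) (shiftBy 2 f) n)
  (cong₂ _+_ (trans (shiftBy-⊕ d f (shift f) n) (cong (shiftBy d f n +_) (shiftBy-shift d f n)))
             (trans (shiftBy-shift d (shift f) n) (shift-cong (shiftBy-shift d f) n)))

PF₂-window : ∀ {f} → PF₂ f → PF₂ (window f)
PF₂-window {f} pf zero = ≼-refl {window f}
-- The only pair of summands in the wrong order is t² f against t f, and the two sides
-- share the summand t f + t² f, which is comparable with itself.
PF₂-window {f} pf (suc zero) = ≼-resp
  (λ n → sym (+-assoc (f n) (shift f n) (shiftBy 2 f n)))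
  (λ n → sym (shiftBy-window 1 f n))
  (≼-⊕ʳ {f ⊕ A} {A} {shiftBy 3 f}
    (≼-⊕ˡ {f} {A} {A} (≼-⊕ʳ {f} {shift f} {shiftBy 2 f} (pf 1) (pf 2)) (≼-refl {A}))
    (≼-⊕ˡ {f} {A} {shiftBy 3 f} (pf 3)
      (≼-⊕ˡ {shift f} {shiftBy 2 f} (shiftBy-mono-≼ 1 (pf 2)) (shiftBy-mono-≼ 2 (pf 1)))))
  where A = shift f ⊕ shiftBy 2 f
PF₂-window {f} pf (suc (suc d)) = ≼-resp (λ _ → refl)
  (λ n → sym (shiftBy-window (2 + d) f n))
  (≼-⊕ʳ {window f} {shiftBy (2 + d) f ⊕ shiftBy (3 + d) f} {shiftBy (4 + d) f}
    (≼-⊕ʳ {window f} {shiftBy (2 + d) f} {shiftBy (3 + d) f} (below d) (below (1 + d)))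
    (below (2 + d)))
  where
  below : ∀ e → window f ≼ shiftBy (2 + e) f
  below e = ≼-⊕ˡ {f ⊕ shift f} {shiftBy 2 f}
    (≼-⊕ˡ {f} {shift f} (pf (2 + e)) (shiftBy-mono-≼ 1 (pf (1 + e))))
    (shiftBy-mono-≼ 2 (pf e))

-- After a strict descent at `k` the ratios of consecutive terms stay below 1, since log-concavity
-- bounds them by the ratio at `k`. The mode is the first descent before `N`, or `N` itself if there
-- is none, as `f` vanishes beyond.
≼-unimodal : ∀ {f N} → f ≼ shift f → (∀ {n} → N < n → f n ≡ 0) → Unimodal f
≼-unimodal {f} {N} f≼ vanish = search
  where
  nondecreasing : ∀ {k} → (∀ {n} → n < k → f n ≤ f (suc n)) → ∀ i j → i ≤ j → j ≤ k → f i ≤ f j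
  nondecreasing step i zero z≤n _ = ≤-refl
  nondecreasing step i (suc j) i≤1+j j<k with m≤n⇒m<n∨m≡n i≤1+j
  ... | inj₁ (s≤s i≤j) = ≤-trans (nondecreasing step i j i≤j (<⇒≤ j<k)) (step j<k)
  ... | inj₂ refl = ≤-refl

  nonincreasing : ∀ {k} → (∀ {n} → k ≤ n → f (suc n) ≤ f n) → ∀ i j → k ≤ i → i ≤ j → f j ≤ f i
  nonincreasing step i zero k≤i z≤n = ≤-refl
  nonincreasing step i (suc j) k≤i i≤1+j with m≤n⇒m<n∨m≡n i≤1+j
  ... | inj₁ (s≤s i≤j) = ≤-trans (step (≤-trans k≤i i≤j)) (nonincreasing step i j k≤i i≤j)
  ... | inj₂ refl = ≤-refl

  descent : ∀ {k} → f (suc k) < f k → ∀ {n} → k ≤ n → f (suc n) ≤ f n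
  descent {k} drop {n} k≤n with f k | f≼ .minor (s≤s k≤n)
  ... | suc v | p = *-cancelˡ-≤ (suc v) (≤-trans (≤-reflexive (*-comm (suc v) (f (suc n))))
          (≤-trans p (*-monoˡ-≤ (f n) (<⇒≤ drop))))

  firstDescent : ∀ k → (∀ {n} → n < k → f n ≤ f (suc n)) ⊎ Unimodal f
  firstDescent zero = inj₁ λ ()
  firstDescent (suc k) with firstDescent k
  ... | inj₂ u = inj₂ u
  ... | inj₁ up with f k ≤? f (suc k)
  ...   | no drop = inj₂ (k , nondecreasing up , nonincreasing (descent (≰⇒> drop)))
  ...   | yes up′ = inj₁ λ n<1+k → helper n<1+k
    where
    helper : ∀ {n} → n < suc k → f n ≤ f (suc n)
    helper (s≤s n≤k) with m≤n⇒m<n∨m≡n n≤k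
    ... | inj₁ n<k = up n<k
    ... | inj₂ refl = up′

  search : Unimodal f
  search with firstDescent N
  ... | inj₂ u = u
  ... | inj₁ up = N , nondecreasing up ,
    nonincreasing λ N≤n → ≤-trans (≤-reflexive (vanish (s≤s N≤n))) z≤n

Unimodal-resp : ∀ {f g} → f ≗ g → Unimodal f → Unimodal g
Unimodal-resp f≗g (k , up , down) =
  k , (λ i j i≤j j≤k → subst₂ _≤_ (f≗g i) (f≗g j) (up i j i≤j j≤k))
    , (λ i j k≤i i≤j → subst₂ _≤_ (f≗g j) (f≗g i) (down i j k≤i i≤j))

-- The Cauchy–Binet inequality

rearrangement : ∀ {u v s t} → u ≤ v → s ≤ t → v * s + u * t ≤ v * t + u * s
rearrangement {u} {s = s} u≤v s≤t with m≤n⇒∃[o]m+o≡n u≤v | m≤n⇒∃[o]m+o≡n s≤t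
... | e , refl | h , refl = ≤-trans (m≤m+n _ (e * h)) (≤-reflexive (expand u e s h))
  where
  expand : ∀ u e s h → ((u + e) * s + u * (s + h)) + e * h ≡ (u + e) * (s + h) + u * s
  expand = solve-∀

∑ : ℕ → Seq → ℕ
∑ zero f = 0
∑ (suc N) f = f 0 + ∑ N (f ∘ suc)

∑-cong : ∀ N {f g} → f ≗ g → ∑ N f ≡ ∑ N g
∑-cong zero f≗g = refl
∑-cong (suc N) f≗g = cong₂ _+_ (f≗g 0) (∑-cong N (f≗g ∘ suc))

∑-⊕ : ∀ N f g → ∑ N (f ⊕ g) ≡ ∑ N f + ∑ N g
∑-⊕ zero f g = refl
∑-⊕ (suc N) f g = trans (cong (f 0 + g 0 +_) (∑-⊕ N (f ∘ suc) (g ∘ suc)))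
  (interchange (f 0) (g 0) (∑ N (f ∘ suc)) (∑ N (g ∘ suc)))
  where
  interchange : ∀ a b c d → (a + b) + (c + d) ≡ (a + c) + (b + d)
  interchange = solve-∀

∑-zero : ∀ N {f} → (∀ l → f l ≡ 0) → ∑ N f ≡ 0
∑-zero zero f≡0 = refl
∑-zero (suc N) f≡0 = cong₂ _+_ (f≡0 0) (∑-zero N (f≡0 ∘ suc))

infix 6 _∙[_]_

_∙[_]_ : Seq → ℕ → Seq → ℕ
α ∙[ N ] y = ∑ N (λ l → α l * y l)

≼-tail : ∀ {f g} → f ≼ g → f ∘ suc ≼ g ∘ suc
≼-tail f≼g .minor a≤b = f≼g .minor (s≤s a≤b)

-- These are the Cauchy-Binet terms pairing a fixed first index, with entries `a`, `b`, `u`, `v`,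
-- with each later `l`: the sum of the products (a β_l - α_l b)(u w_l - y_l v) of non-negative
-- minors.
cauchyBinet-cross : ∀ N a b u v α β y w →
  (∀ l → α l * b ≤ a * β l) → (∀ l → y l * v ≤ u * w l) →
  (a * v) * (β ∙[ N ] y) + (α ∙[ N ] w) * (b * u) ≤ (a * u) * (β ∙[ N ] w) + (α ∙[ N ] y) * (b * v)
cauchyBinet-cross zero a b u v _ _ _ _ _ _ = ≤-reflexive (vanish (a * v) (a * u))
  where
  vanish : ∀ s t → s * 0 + 0 ≡ t * 0 + 0
  vanish = solve-∀
cauchyBinet-cross (suc N) a b u v α β y w αβ yw =
  subst₂ _≤_
    (regroup₁ a b u v (α 0) (β 0) (y 0) (w 0) ((β ∘ suc) ∙[ N ] (y ∘ suc)) ((α ∘ suc) ∙[ N ] (w ∘ suc)))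
    (regroup₂ a b u v (α 0) (β 0) (y 0) (w 0) ((β ∘ suc) ∙[ N ] (w ∘ suc)) ((α ∘ suc) ∙[ N ] (y ∘ suc)))
    (+-mono-≤ (rearrangement (αβ 0) (yw 0)) (cauchyBinet-cross N a b u v (α ∘ suc) (β ∘ suc) (y ∘ suc) (w ∘ suc) (αβ ∘ suc) (yw ∘ suc)))
  where
  regroup₁ : ∀ a b u v α₀ β₀ y₀ w₀ S T →
    ((a * β₀) * (y₀ * v) + (α₀ * b) * (u * w₀)) + ((a * v) * S + T * (b * u))
      ≡ (a * v) * (β₀ * y₀ + S) + (α₀ * w₀ + T) * (b * u)
  regroup₁ = solve-∀
  regroup₂ : ∀ a b u v α₀ β₀ y₀ w₀ S T →
    ((a * β₀) * (u * w₀) + (α₀ * b) * (y₀ * v)) + ((a * u) * S + T * (b * v))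
      ≡ (a * u) * (β₀ * w₀ + S) + (α₀ * y₀ + T) * (b * v)
  regroup₂ = solve-∀

-- The difference of the sides is the sum, over pairs of indices, of products of two minors. Index 0
-- is split off: its diagonal term cancels, and the pairs containing it form the cross terms.
cauchyBinet : ∀ N {α β y w} → α ≼ β → y ≼ w →
  (α ∙[ N ] w) * (β ∙[ N ] y) ≤ (α ∙[ N ] y) * (β ∙[ N ] w)
cauchyBinet zero _ _ = z≤n
cauchyBinet (suc N) {α} {β} {y} {w} α≼β y≼w = subst₂ _≤_
  (regroup₁ (α 0) (β 0) (y 0) (w 0) ((β ∘ suc) ∙[ N ] (y ∘ suc)) ((α ∘ suc) ∙[ N ] (w ∘ suc)))
  (regroup₂ (α 0) (β 0) (y 0) (w 0) ((β ∘ suc) ∙[ N ] (w ∘ suc)) ((α ∘ suc) ∙[ N ] (y ∘ suc)))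
  (+-monoʳ-≤ (α 0 * w 0 * (β 0 * y 0))
    (+-mono-≤ (cauchyBinet N (≼-tail α≼β) (≼-tail y≼w))
      (cauchyBinet-cross N (α 0) (β 0) (y 0) (w 0) (α ∘ suc) (β ∘ suc) (y ∘ suc) (w ∘ suc)
        (λ l → α≼β .minor z≤n) (λ l → y≼w .minor z≤n))))
  where
  regroup₁ : ∀ α₀ β₀ y₀ w₀ S T →
    α₀ * w₀ * (β₀ * y₀) + (T * S + ((α₀ * w₀) * S + T * (β₀ * y₀)))
      ≡ (α₀ * w₀ + T) * (β₀ * y₀ + S)
  regroup₁ = solve-∀
  regroup₂ : ∀ α₀ β₀ y₀ w₀ S T →
    α₀ * w₀ * (β₀ * y₀) + (T * S + ((α₀ * y₀) * S + T * (β₀ * w₀)))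
      ≡ (α₀ * y₀ + T) * (β₀ * w₀ + S)
  regroup₂ = solve-∀

-- Binomial combinations of two interlacing sequences

binomial : ℕ → Seq
binomial zero = δ
binomial (suc M) = binomial M ⊕ shift (binomial M)

binomial-PF₂ : ∀ M → PF₂ (binomial M)
binomial-PF₂ zero = δ-PF₂
binomial-PF₂ (suc M) = PF₂-1+t (binomial-PF₂ M)

binomial-0 : ∀ M → binomial M 0 ≡ 1
binomial-0 zero = refl
binomial-0 (suc M) = cong (_+ 0) (binomial-0 M)

weight : ℕ → Seq
weight M l = binomial M ⌈ l /2⌉

-- Raising `l` by two raises ⌈l/2⌉ by one, so this is the log-concavity of the binomial row.
weight-≼ : ∀ M → weight M ≼ shiftBy 2 (weight M)
weight-≼ M = ≼-shiftBy 2 λ a≤b → binomial-PF₂ M 1 .minor (s≤s (⌈n/2⌉-mono a≤b))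

-- Two steps in the index multiply by x, so multiplying a combination of these sequences by x merely
-- moves its weights by two.
interleave : Seq → Seq → ℕ → Seq
interleave c p zero = c
interleave c p (suc zero) = p
interleave c p (suc (suc l)) = shift (interleave c p l)

-- All shifts `d` are recorded because `≼` is not transitive, so comparisons of neighbours in the
-- interleaved sequence could not be chained.
record Interlacing (c p : Seq) : Set where
  field
    c≼c : PF₂ c
    p≼p : PF₂ p
    c≼p : ∀ d → c ≼ shiftBy d p
    p≼c : ∀ d → p ≼ shiftBy (suc d) c

open Interlacing

module _ {c p : Seq} (cp : Interlacing c p) where

  private
    z : ℕ → Seq
    z = interleave c p

  c≼interleave : ∀ m d → c ≼ shiftBy d (z m)
  c≼interleave zero d = cp .c≼c d
  c≼interleave (suc zero) d = cp .c≼p d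
  c≼interleave (suc (suc m)) d =
    ≼-resp (λ _ → refl) (λ k → sym (shiftBy-shift d (z m) k)) (c≼interleave m (suc d))

  p≼interleave : ∀ m d → p ≼ shiftBy d (z (suc m))
  p≼interleave zero d = cp .p≼p d
  p≼interleave (suc zero) d =
    ≼-resp (λ _ → refl) (λ k → sym (shiftBy-shift d c k)) (cp .p≼c d)
  p≼interleave (suc (suc m)) d =
    ≼-resp (λ _ → refl) (λ k → sym (shiftBy-shift d (z (suc m)) k)) (p≼interleave m (suc d))

  interleave-mono : ∀ {l m} → l ≤ m → z l ≼ z m
  interleave-mono {zero} {m} _ = c≼interleave m 0
  interleave-mono {suc zero} {suc m} _ = p≼interleave m 0
  interleave-mono {suc (suc l)} (s≤s (s≤s l≤m)) = shift-mono-≼ (interleave-mono l≤m)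

module _ {c p : Seq} {G : ℕ → Seq}
         (G-zero : G 0 ≗ c) (G-suc : ∀ M → G (suc M) ≗ G M ⊕ shift (G M) ⊕ p) where

  private
    z : ℕ → Seq
    z = interleave c p

  ∑-shift : ∀ N M {g} → (∀ k → g k ≡ weight M ∙[ N ] (λ l → z l k)) →
    ∀ k → shift g k ≡ weight M ∙[ N ] (λ l → shift (z l) k)
  ∑-shift N M g≡ zero = sym (∑-zero N λ l → *-zeroʳ (weight M l))
  ∑-shift N M g≡ (suc k) = g≡ k

  -- In closed form, G_M = (1 + x)ᴹ c + (((1 + x)ᴹ − 1) / x) p.
  G-expansion : ∀ M N → M * 2 < N → ∀ k → G M k ≡ weight M ∙[ N ] (λ l → z l k)
  G-expansion zero (suc N) _ k =
    trans (G-zero k) (trans (sym (trans (+-identityʳ (1 * c k)) (*-identityˡ (c k))))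
      (cong (1 * c k +_) (sym (∑-zero N λ _ → refl))))
  G-expansion (suc M) (suc (suc N)) (s≤s (s≤s M<N)) k =
    trans (G-suc M k)
      (trans (cong (_+ p k) (cong₂ _+_
          (G-expansion M (2 + N) (≤-trans M<N (m≤n+m N 2)) k)
          (∑-shift N M (G-expansion M N M<N) k)))
        (trans (pascal (binomial M 0) (c k) (binomial M 1) (p k)
                  (∑ N (λ l → binomial M (suc ⌈ l /2⌉) * shift (z l) k))
                  (∑ N (λ l → binomial M ⌈ l /2⌉ * shift (z l) k)) (binomial-0 M))
          (cong (λ s → (binomial M 0 + 0) * c k + ((binomial M 1 + binomial M 0) * p k + s))
            (trans (sym (∑-⊕ N (λ l → binomial M (suc ⌈ l /2⌉) * shift (z l) k)
                               (λ l → binomial M ⌈ l /2⌉ * shift (z l) k)))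
              (∑-cong N λ l → sym (*-distribʳ-+ (shift (z l) k)
                 (binomial M (suc ⌈ l /2⌉)) (binomial M ⌈ l /2⌉)))))))
    where
    -- The lone `p` supplies the summand C(M,0) = 1 in Pascal's rule for the weight of `p`; for
    -- later indices x G supplies it.
    pascal : ∀ b₀ c₀ b₁ p₀ S T → b₀ ≡ 1 →
      (b₀ * c₀ + (b₁ * p₀ + S)) + T + p₀ ≡ (b₀ + 0) * c₀ + ((b₁ + b₀) * p₀ + (S + T))
    pascal b₀ c₀ b₁ p₀ S T refl = ring c₀ b₁ p₀ S T
      where
      ring : ∀ c₀ b₁ p₀ S T →
        (1 * c₀ + (b₁ * p₀ + S)) + T + p₀ ≡ 1 * c₀ + ((b₁ + 1) * p₀ + (S + T))
      ring = solve-∀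

  G-≼ : Interlacing c p → ∀ M → G M ≼ shift (G M)
  G-≼ cp M .minor {a} {b} a≤b = subst₂ _≤_
    (cong₂ _*_ (sym (expand b)) (sym (expand-shift a)))
    (cong₂ _*_ (sym (expand a)) (sym (expand-shift b)))
    (cauchyBinet (2 + N) (weight-≼ M) columns)
    where
    -- The weights vanish beyond index 2M. Two more terms make room for the shifted weights, so that
    -- both sums have equal length.
    N = suc (M * 2)
    expand : ∀ k → G M k ≡ weight M ∙[ 2 + N ] (λ l → z l k)
    expand = G-expansion M (2 + N) (m≤n+m N 2)
    expand-shift : ∀ k → shift (G M) k ≡ shiftBy 2 (weight M) ∙[ 2 + N ] (λ l → z l k)
    expand-shift = ∑-shift N M (G-expansion M N ≤-refl)
    columns : (λ l → z l a) ≼ (λ l → z l b)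
    columns .minor {l} {m} l≤m = ≤-trans (≤-reflexive (*-comm (z m a) (z l b)))
      (interleave-mono cp l≤m .minor a≤b)

-- Rows of trinomial type and their columns

record Trinomial (R : ℕ → Seq) : Set where
  field
    base : PF₂ (R 0)
    step : ∀ k → R (suc k) ≗ shift (window (R k))

open Trinomial

column : (ℕ → Seq) → ℕ → Seq
column R n k = R k n

-- Multiplication of each row by t + t².
previous : (ℕ → Seq) → ℕ → Seq
previous R k = shift (R k) ⊕ shiftBy 2 (R k)

module _ {R : ℕ → Seq} (tri : Trinomial R) where

  row-PF₂ : ∀ k → PF₂ (R k)
  row-PF₂ zero = tri .base
  row-PF₂ (suc k) =
    PF₂-resp (λ n → sym (tri .step k n)) (PF₂-shift (PF₂-window (row-PF₂ k)))

  shiftBy-row : ∀ d k → shiftBy d (R (suc k)) ≗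
    shiftBy (1 + d) (R k) ⊕ shiftBy (2 + d) (R k) ⊕ shiftBy (3 + d) (R k)
  shiftBy-row d k n = trans (shiftBy-cong d (tri .step k) n)
    (trans (shiftBy-shift d (window (R k)) n) (shiftBy-window (suc d) (R k) n))

  -- Row `e + k` is a sum of shifts of row `k`, each comparable with row `k` by log-concavity.
  row-≼-shiftBy : ∀ e d k → R k ≼ shiftBy d (R (e + k))
  row-≼-shiftBy zero d k = row-PF₂ k d
  row-≼-shiftBy (suc e) d k = ≼-resp (λ _ → refl) (λ n → sym (shiftBy-row d (e + k) n))
    (≼-⊕ʳ {R k} {shiftBy (1 + d) (R (e + k)) ⊕ shiftBy (2 + d) (R (e + k))}
      (≼-⊕ʳ (row-≼-shiftBy e (1 + d) k) (row-≼-shiftBy e (2 + d) k))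
      (row-≼-shiftBy e (3 + d) k))

  row-mono : ∀ {a b} → a ≤ b → R a ≼ R b
  row-mono {a} a≤b with m≤n⇒∃[o]m+o≡n a≤b
  ... | e , refl rewrite +-comm a e = row-≼-shiftBy e 0 a

  -- Expanding the higher rows down to rows a and b reduces this to `≼-lag`, term by term.
  column-minors : ∀ {a b} → a ≤ b → ∀ d s n →
    shiftBy s (R (d + b)) n * R a n ≤ shiftBy s (R (d + a)) n * R b n
  column-minors a≤b zero s n = ≼-lag (row-mono a≤b) s ≤-refl
  column-minors {a} {b} a≤b (suc d) s n
    rewrite shiftBy-row s (d + b) n | shiftBy-row s (d + a) n
    = subst₂ _≤_
        (sym (distrib (D b 1) (D b 2) (D b 3) (R a n)))
        (sym (distrib (D a 1) (D a 2) (D a 3) (R b n)))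
        (+-mono-≤ (+-mono-≤ (column-minors a≤b d (1 + s) n) (column-minors a≤b d (2 + s) n))
          (column-minors a≤b d (3 + s) n))
    where
    D : ℕ → ℕ → ℕ
    D c e = shiftBy (e + s) (R (d + c)) n
    distrib : ∀ u v w x → (u + v + w) * x ≡ u * x + v * x + w * x
    distrib = solve-∀

  column-PF₂ : ∀ n → PF₂ (column R n)
  column-PF₂ n d = ≼-shiftBy d λ a≤b → column-minors a≤b d 0 n

  previous-trinomial : Trinomial (previous R)
  previous-trinomial .base = PF₂-1+t (PF₂-shift (tri .base))
  previous-trinomial .step k n = trans
    (cong₂ _+_ (shiftBy-row 1 k n) (shiftBy-row 2 k n))
    (trans (regroup (D 2) (D 3) (D 4) (D 5))
      (sym (trans (shiftBy-window 1 (previous R k) n)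
        (cong₂ _+_ (cong₂ _+_ (shiftBy-⊕ 1 (shift (R k)) (shiftBy 2 (R k)) n)
                              (shiftBy-⊕ 2 (shift (R k)) (shiftBy 2 (R k)) n))
                   (shiftBy-⊕ 3 (shift (R k)) (shiftBy 2 (R k)) n)))))
    where
    D : ℕ → ℕ
    D e = shiftBy e (R k) n
    regroup : ∀ u v w x → (u + v + w) + (v + w + x) ≡ (u + v) + (v + w) + (w + x)
    regroup = solve-∀

module _ {R : ℕ → Seq} (tri : Trinomial R) (n : ℕ) where

  private
    c p : Seq
    c = column R n
    p = shift (column (previous R) n)

  p≤c : ∀ k → p k ≤ c k
  p≤c zero = z≤n
  p≤c (suc k) = ≤-trans (m≤m+n _ (shiftBy 3 (R k) n)) (≤-reflexive (sym (shiftBy-row tri 0 k n)))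

  -- With lags 1, 2, 3 on one side and 1, 2 on the other, lags 1 and 2 cancel.
  column-≼-p : c ≼ p
  column-≼-p = ≼-shiftBy 1 λ {a} {b} a≤b → subst₂ _≤_
    (cong (_* previous R a n) (sym (shiftBy-row tri 0 b n)))
    (cong (_* previous R b n) (sym (shiftBy-row tri 0 a n)))
    (cancel (shift (R b) n) (shiftBy 2 (R b) n) (shiftBy 3 (R b) n)
            (shift (R a) n) (shiftBy 2 (R a) n) (shiftBy 3 (R a) n)
      (≼-lag (shiftBy-mono-≼ 1 (row-mono tri a≤b)) 2 (≤-refl {n}))
      (≼-lag (shiftBy-mono-≼ 2 (row-mono tri a≤b)) 1 (≤-refl {n})))
    where
    cancel : ∀ q₁ q₂ q₃ r₁ r₂ r₃ → q₃ * r₁ ≤ r₃ * q₁ → q₃ * r₂ ≤ r₃ * q₂ →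
      (q₁ + q₂ + q₃) * (r₁ + r₂) ≤ (r₁ + r₂ + r₃) * (q₁ + q₂)
    cancel q₁ q₂ q₃ r₁ r₂ r₃ h₁ h₂ = subst₂ _≤_
      (expandˡ q₁ q₂ q₃ r₁ r₂) (expandʳ q₁ q₂ r₁ r₂ r₃)
      (+-monoʳ-≤ ((q₁ + q₂) * (r₁ + r₂)) (+-mono-≤ h₁ h₂))
      where
      expandˡ : ∀ q₁ q₂ q₃ r₁ r₂ →
        (q₁ + q₂) * (r₁ + r₂) + (q₃ * r₁ + q₃ * r₂) ≡ (q₁ + q₂ + q₃) * (r₁ + r₂)
      expandˡ = solve-∀
      expandʳ : ∀ q₁ q₂ r₁ r₂ r₃ →
        (q₁ + q₂) * (r₁ + r₂) + (r₃ * q₁ + r₃ * q₂) ≡ (r₁ + r₂ + r₃) * (q₁ + q₂)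
      expandʳ = solve-∀

  column-interlacing : Interlacing c p
  column-interlacing .c≼c = column-PF₂ tri n
  column-interlacing .p≼p = PF₂-shift (column-PF₂ (previous-trinomial tri) n)
  -- The chain through xᵈ c is legitimate because `p≤c` provides the pointwise bound that `≼-trans`
  -- demands.
  column-interlacing .c≼p d =
    ≼-trans (shiftBy-mono-≤ d) (column-PF₂ tri n d) (shiftBy-mono-≼ d column-≼-p)
    where
    shiftBy-mono-≤ : ∀ d k → shiftBy d p k ≤ shiftBy d c k
    shiftBy-mono-≤ zero k = p≤c k
    shiftBy-mono-≤ (suc d) zero = z≤n
    shiftBy-mono-≤ (suc d) (suc k) = shiftBy-mono-≤ d k
  -- After removing a common x, the two terms of t + t² are the lags 1 and 2 in `column-minors`.
  column-interlacing .p≼c d = shift-mono-≼ (≼-shiftBy d λ {a} {b} a≤b → subst₂ _≤_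
    (sym (*-distribʳ-+ (R a n) (shift (R (d + b)) n) (shiftBy 2 (R (d + b)) n)))
    (sym (*-distribʳ-+ (R b n) (shift (R (d + a)) n) (shiftBy 2 (R (d + a)) n)))
    (+-mono-≤ (column-minors tri a≤b d 1 n) (column-minors tri a≤b d 2 n)))

-- Counting subsets by size

count : ∀ N → (Subset N → Bool) → Seq
count zero P = if P [] then δ else (λ _ → 0)
count (suc N) P = shift (count N (λ U → P (true ∷ U))) ⊕ count N (λ U → P (false ∷ U))

count-cong : ∀ N {P Q} → P ≗ Q → count N P ≗ count N Q
count-cong zero P≗Q i rewrite P≗Q [] = refl
count-cong (suc N) P≗Q i = cong₂ _+_
  (shift-cong (count-cong N (λ U → P≗Q (true ∷ U))) i) (count-cong N (λ U → P≗Q (false ∷ U)) i)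

count-false : ∀ N → count N (λ _ → false) ≗ (λ _ → 0)
count-false zero i = refl
count-false (suc N) zero = count-false N zero
count-false (suc N) (suc i) = cong₂ _+_ (count-false N i) (count-false N (suc i))

count-vanish : ∀ N P {i} → N < i → count N P i ≡ 0
count-vanish zero P (s≤s _) with P []
... | true = refl
... | false = refl
count-vanish (suc N) P (s≤s N<i) =
  cong₂ _+_ (count-vanish N _ N<i) (count-vanish N _ (m≤n⇒m≤1+n N<i))

length-filter-map : ∀ {A B : Set} (Q : B → Bool) (f : A → B) xs →
  length (filter (T? ∘ Q) (map f xs)) ≡ length (filter (T? ∘ Q ∘ f) xs)
length-filter-map Q f [] = refl
length-filter-map Q f (x ∷ xs) with Q (f x)
... | true = cong suc (length-filter-map Q f xs)
... | false = length-filter-map Q f xs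

length-filter-∧-false : ∀ {A : Set} (Q : A → Bool) xs →
  length (filter (λ x → T? (Q x ∧ false)) xs) ≡ 0
length-filter-∧-false Q [] = refl
length-filter-∧-false Q (x ∷ xs) with Q x
... | true = length-filter-∧-false Q xs
... | false = length-filter-∧-false Q xs

length-filter≡count : ∀ N P i →
  length (filter (λ U → T? (P U ∧ (∣ U ∣ ≡ᵇ i))) (allSubsets N)) ≡ count N P i
length-filter≡count zero P i with P [] | i
... | true | zero = refl
... | true | suc _ = refl
... | false | _ = refl
length-filter≡count (suc N) P i = trans
  (cong length (filter-++ (T? ∘ Q) (map (true ∷_) (allSubsets N)) (map (false ∷_) (allSubsets N))))
  (trans (length-++ (filter (T? ∘ Q) (map (true ∷_) (allSubsets N))))
    (cong₂ _+_
      (trans (length-filter-map Q (true ∷_) (allSubsets N)) (with-true i))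
      (trans (length-filter-map Q (false ∷_) (allSubsets N))
        (length-filter≡count N (λ U → P (false ∷ U)) i))))
  where
  Q : Subset (suc N) → Bool
  Q U = P U ∧ (∣ U ∣ ≡ᵇ i)
  with-true : ∀ i → length (filter (λ U → T? (P (true ∷ U) ∧ (suc ∣ U ∣ ≡ᵇ i))) (allSubsets N))
    ≡ shift (count N (λ U → P (true ∷ U))) i
  with-true zero = length-filter-∧-false (λ U → P (true ∷ U)) (allSubsets N)
  with-true (suc i) = length-filter≡count N (λ U → P (true ∷ U)) i

-- Scanning predicates for paths and lollipops, and their recurrences

-- Positions out of range count as not chosen, so the far end of the path needs no special case.
at : ∀ {N} → Subset N → ℕ → Bool
at [] _ = false
at (u ∷ U) zero = u
at (u ∷ U) (suc i) = at U i

-- `path b U`: the path vertices are dominated by U together with, if b holds,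
-- an extra vertex attached in front.
path : ∀ {n} → Bool → Subset n → Bool
path b [] = true
path b (u ∷ U) = (b ∨ u ∨ at U 0) ∧ path u U

-- Domination in the lollipop whose clique consists of the first 1 + M vertices and at least
-- one earlier vertex; `seen` says whether one of the earlier ones is chosen.
lollipop : ∀ M {n} → Bool → Subset (suc M + n) → Bool
lollipop zero seen (w ∷ U) = (seen ∨ w) ∧ path w U
lollipop (suc M) seen (u ∷ U) = lollipop M (seen ∨ u) U

pathRow : ℕ → Seq
pathRow k n = count n (path true) k

-- With nothing chosen in front, the first chosen vertex is the first or the second one; this gives
-- x (t + t²), and `path true` remains behind it.
count-path-false : ∀ n →
  count (suc n) (path false) ≗ shift (column (previous pathRow) (suc n))
count-path-false zero zero = refl
count-path-false zero (suc k) = refl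
count-path-false (suc n) zero = count-false n 0
count-path-false (suc n) (suc k) =
  cong (pathRow k (suc n) +_) (trans (cong (pathRow k n +_) (count-false n (suc k)))
    (+-identityʳ (pathRow k n)))

-- With a chosen vertex in front, the next chosen one is at distance 1, 2 or 3. The empty set
-- suffices exactly for paths of length 0 and 1, whence the base 1 + t.
pathRow-trinomial : Trinomial pathRow
pathRow-trinomial .base = PF₂-resp row₀ (PF₂-1+t δ-PF₂)
  where
  row₀ : δ ⊕ shift δ ≗ pathRow 0
  row₀ zero = refl
  row₀ (suc zero) = refl
  row₀ (suc (suc n)) = sym (count-path-false n 0)
pathRow-trinomial .step k zero = refl
pathRow-trinomial .step k (suc zero) = sym (+-identityʳ _)
pathRow-trinomial .step k (suc (suc n)) =
  trans (cong (pathRow k (suc n) +_) (count-path-false n (suc k)))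
    (sym (+-assoc (pathRow k (suc n)) (pathRow k n) (shift (pathRow k) n)))

-- An earlier chosen vertex additionally admits the sets missing the rest of the clique; these
-- dominate the path unaided.
count-lollipop-true : ∀ M n k →
  count (suc M + n) (lollipop M true) k ≡ count (suc M + n) (lollipop M false) k + count n (path false) k
count-lollipop-true zero n k = cong (_+ count n (path false) k)
  (sym (trans (cong (shift (count n (path true)) k +_) (count-false n k)) (+-identityʳ _)))
count-lollipop-true (suc M) n k =
  trans (cong (shift (count (suc M + n) (lollipop M true)) k +_) (count-lollipop-true M n k))
    (sym (+-assoc (shift (count (suc M + n) (lollipop M true)) k) _ _))

count-lollipop-0 : ∀ M n → count (suc M + n) (lollipop M false) 0 ≡ 0
count-lollipop-0 zero n = count-false n 0
count-lollipop-0 (suc M) n = count-lollipop-0 M n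

module _ (n : ℕ) where

  -- Division by x, which loses nothing by `count-lollipop-0`; this is the G of the binomial
  -- expansion.
  lollipopTail : ℕ → Seq
  lollipopTail M k = count (suc M + n) (lollipop M false) (suc k)

  count-lollipop-false : ∀ M → count (suc M + n) (lollipop M false) ≗ shift (lollipopTail M)
  count-lollipop-false M zero = count-lollipop-0 M n
  count-lollipop-false M (suc k) = refl

  lollipopTail-zero : lollipopTail 0 ≗ column pathRow n
  lollipopTail-zero k = trans (cong (pathRow k n +_) (count-false n (suc k))) (+-identityʳ _)

  lollipopTail-suc : ∀ M →
    lollipopTail (suc M) ≗ lollipopTail M ⊕ shift (lollipopTail M) ⊕ count n (path false)
  lollipopTail-suc M k = trans
    (cong (_+ lollipopTail M k) (trans (count-lollipop-true M n k)
      (cong (_+ count n (path false) k) (count-lollipop-false M k))))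
    (regroup (shift (lollipopTail M) k) (count n (path false) k) (lollipopTail M k))
    where
    regroup : ∀ u v w → (u + v) + w ≡ w + u + v
    regroup = solve-∀

lollipop-unimodal : ∀ M n → Unimodal (count (suc M + suc n) (lollipop M false))
lollipop-unimodal M n = ≼-unimodal
  (≼-resp (λ k → sym (count-lollipop-false (suc n) M k))
    (λ k → sym (shift-cong (count-lollipop-false (suc n) M) k))
    (shift-mono-≼ (G-≼ (lollipopTail-zero (suc n)) tail-suc
      (column-interlacing pathRow-trinomial (suc n)) M)))
  (count-vanish (suc M + suc n) (lollipop M false))
  where
  tail-suc : ∀ M → lollipopTail (suc n) (suc M) ≗
    lollipopTail (suc n) M ⊕ shift (lollipopTail (suc n) M) ⊕ shift (column (previous pathRow) (suc n))
  tail-suc M k = trans (lollipopTail-suc (suc n) M k)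
    (cong (lollipopTail (suc n) M k + shift (lollipopTail (suc n) M) k +_) (count-path-false n k))

path-unimodal : ∀ n → Unimodal (count (suc n) (path false))
path-unimodal n = ≼-unimodal
  (≼-resp (λ k → sym (count-path-false n k)) (λ k → sym (shift-cong (count-path-false n) k))
    (column-interlacing pathRow-trinomial (suc n) .p≼p 1))
  (count-vanish (suc n) (path false))

-- Domination in the lollipop graph as a scan along the vertices

at-toℕ : ∀ {N} (U : Subset N) v → at U (toℕ v) ≡ lookup U v
at-toℕ (u ∷ U) Fin.zero = refl
at-toℕ (u ∷ U) (Fin.suc v) = at-toℕ U v

at-< : ∀ {N} (U : Subset N) i → T (at U i) → i < N
at-< (u ∷ U) zero _ = s≤s z≤n
at-< (u ∷ U) (suc i) Ui = s≤s (at-< U i Ui)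

module _ {x y : Bool} where
  open Equivalence (T-∧ {x} {y}) public using () renaming (to to T-∧⁻; from to T-∧⁺)
  open Equivalence (T-∨ {x} {y}) public using () renaming (to to T-∨⁻; from to T-∨⁺)

Adjacent : ℕ → ℕ → ℕ → Set
Adjacent m u v = (u < m × v < m × u ≢ v) ⊎ (suc u ≡ v × m ≤ v) ⊎ (suc v ≡ u × m ≤ u)

Dominates : ℕ → ∀ {N} → Subset N → Set
Dominates m {N} U = ∀ v → v < N → T (at U v) ⊎ ∃ λ u → T (at U u) × Adjacent m u v

T-not⁻ : ∀ {b} → T (not b) → ¬ T b
T-not⁻ {false} _ ()

T-not⁺ : ∀ {b} → ¬ T b → T (not b)
T-not⁺ {false} _ = _
T-not⁺ {true} ¬b = ¬b _

lollipopAdj⇒Adjacent : ∀ m n u v → T (lollipopAdj m n u v) → Adjacent m (toℕ u) (toℕ v)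
lollipopAdj⇒Adjacent m n u v uv with T-∨⁻ uv
... | inj₁ clique with T-∧⁻ clique
...   | u<m , rest with T-∧⁻ rest
...     | v<m , u≢v = inj₁ (<ᵇ⇒< _ _ u<m , <ᵇ⇒< _ _ v<m , λ u≡v → T-not⁻ u≢v (≡⇒≡ᵇ _ _ u≡v))
lollipopAdj⇒Adjacent m n u v uv | inj₂ onPath with T-∨⁻ onPath
... | inj₁ next with T-∧⁻ {suc (toℕ u) ≡ᵇ toℕ v} next
...   | eq , v≮m = inj₂ (inj₁ (≡ᵇ⇒≡ _ _ eq , ≮⇒≥ (T-not⁻ v≮m ∘ <⇒<ᵇ)))
lollipopAdj⇒Adjacent m n u v uv | inj₂ onPath | inj₂ next with T-∧⁻ {suc (toℕ v) ≡ᵇ toℕ u} next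
...   | eq , u≮m = inj₂ (inj₂ (≡ᵇ⇒≡ _ _ eq , ≮⇒≥ (T-not⁻ u≮m ∘ <⇒<ᵇ)))

Adjacent⇒lollipopAdj : ∀ m n u v → Adjacent m (toℕ u) (toℕ v) → T (lollipopAdj m n u v)
Adjacent⇒lollipopAdj m n u v (inj₁ (u<m , v<m , u≢v)) =
  T-∨⁺ (inj₁ (T-∧⁺ (<⇒<ᵇ u<m , T-∧⁺ (<⇒<ᵇ v<m , T-not⁺ (u≢v ∘ ≡ᵇ⇒≡ _ _)))))
Adjacent⇒lollipopAdj m n u v (inj₂ (inj₁ (eq , m≤v))) =
  T-∨⁺ {(toℕ u <ᵇ m) ∧ _} (inj₂ (T-∨⁺ (inj₁ (T-∧⁺ (≡⇒≡ᵇ _ _ eq , T-not⁺ (≤⇒≯ m≤v ∘ <ᵇ⇒< _ _))))))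
Adjacent⇒lollipopAdj m n u v (inj₂ (inj₂ (eq , m≤u))) =
  T-∨⁺ {(toℕ u <ᵇ m) ∧ _} (inj₂ (T-∨⁺ {(suc (toℕ u) ≡ᵇ toℕ v) ∧ _}
    (inj₂ (T-∧⁺ (≡⇒≡ᵇ _ _ eq , T-not⁺ (≤⇒≯ m≤u ∘ <ᵇ⇒< _ _))))))

isDominating⇒Dominates : ∀ m n (U : Subset (m + n)) →
  T (isDominating (lollipopAdj m n) U) → Dominates m U
isDominating⇒Dominates m n U dom v v<N with T-∨⁻ (All.lookup (all⁺ _ _ dom) (∈-allFin (fromℕ< v<N)))
... | inj₁ Uv = inj₁ (subst T (trans (sym (at-toℕ U (fromℕ< v<N))) (cong (at U) (toℕ-fromℕ< v<N))) Uv)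
... | inj₂ any-u with satisfied (any⁻ _ (allFin (m + n)) any-u)
...   | u , Uu∧uv with T-∧⁻ {lookup U u} Uu∧uv
...     | Uu , uv = inj₂ (toℕ u , subst T (sym (at-toℕ U u)) Uu ,
            subst (Adjacent m (toℕ u)) (toℕ-fromℕ< v<N) (lollipopAdj⇒Adjacent m n u (fromℕ< v<N) uv))

Dominates⇒isDominating : ∀ m n (U : Subset (m + n)) →
  Dominates m U → T (isDominating (lollipopAdj m n) U)
Dominates⇒isDominating m n U dom = all⁻ _ (All.universal dominated (allFin (m + n)))
  where
  dominated : ∀ v → T (lookup U v ∨ any (λ u → lookup U u ∧ lollipopAdj m n u v) (allFin (m + n)))
  dominated v with dom (toℕ v) (toℕ<n v)
  ... | inj₁ Uv = T-∨⁺ (inj₁ (subst T (at-toℕ U v) Uv))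
  ... | inj₂ (u , Uu , uv) = T-∨⁺ {lookup U v} (inj₂ (any⁺ _ (lose (∈-allFin u′) (T-∧⁺
          ( subst T (trans (cong (at U) (sym toℕ-u′)) (at-toℕ U u′)) Uu
          , Adjacent⇒lollipopAdj m n u′ v (subst (λ w → Adjacent m w (toℕ v)) (sym toℕ-u′) uv))))))
    where
    u<N = at-< U u Uu
    u′ = fromℕ< u<N
    toℕ-u′ = toℕ-fromℕ< u<N

-- The closed neighbourhood of path vertex 1 + i, indexed by its left neighbour so that the extra
-- vertex in front fits in.
Near : ∀ {N} → Subset N → ℕ → Set
Near U i = T (at U i) ⊎ T (at U (1 + i)) ⊎ T (at U (2 + i))

path⇒Near : ∀ {n} b (U : Subset n) → T (path b U) → ∀ i → i < n → Near (b ∷ U) i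
path⇒Near b (u ∷ U) ok zero _ with T-∨⁻ (proj₁ (T-∧⁻ {b ∨ u ∨ at U 0} ok))
... | inj₁ prev = inj₁ prev
... | inj₂ rest = inj₂ (T-∨⁻ rest)
path⇒Near b (u ∷ U) ok (suc i) (s≤s i<n) =
  path⇒Near u U (proj₂ (T-∧⁻ {b ∨ u ∨ at U 0} ok)) i i<n

Near⇒path : ∀ {n} b (U : Subset n) → (∀ i → i < n → Near (b ∷ U) i) → T (path b U)
Near⇒path b [] near = _
Near⇒path b (u ∷ U) near =
  T-∧⁺ (first (near 0 (s≤s z≤n)) , Near⇒path u U (λ i i<n → near (suc i) (s≤s i<n)))
  where
  first : Near (b ∷ u ∷ U) 0 → T (b ∨ u ∨ at U 0)
  first (inj₁ prev) = T-∨⁺ (inj₁ prev)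
  first (inj₂ rest) = T-∨⁺ {b} (inj₂ (T-∨⁺ rest))

lollipop⇒ : ∀ M {n} seen (U : Subset (suc M + n)) → T (lollipop M seen U) →
  (T seen ⊎ ∃ λ i → i ≤ M × T (at U i)) × (∀ i → i < n → Near U (M + i))
lollipop⇒ zero seen (w ∷ U) ok with T-∧⁻ {seen ∨ w} ok
... | chosen , onPath with T-∨⁻ {seen} chosen
...   | inj₁ s = inj₁ s , path⇒Near w U onPath
...   | inj₂ Uw = inj₂ (0 , z≤n , Uw) , path⇒Near w U onPath
lollipop⇒ (suc M) seen (u ∷ U) ok with lollipop⇒ M (seen ∨ u) U ok
... | inj₂ (i , i≤M , Ui) , near = inj₂ (suc i , s≤s i≤M , Ui) , near
... | inj₁ seen∨u , near with T-∨⁻ {seen} seen∨u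
...   | inj₁ s = inj₁ s , near
...   | inj₂ Uu = inj₂ (0 , z≤n , Uu) , near

⇒lollipop : ∀ M {n} seen (U : Subset (suc M + n)) →
  T seen ⊎ (∃ λ i → i ≤ M × T (at U i)) → (∀ i → i < n → Near U (M + i)) → T (lollipop M seen U)
⇒lollipop zero seen (w ∷ U) chosen near = T-∧⁺ (T-∨⁺ (first chosen) , Near⇒path w U near)
  where
  first : T seen ⊎ (∃ λ i → i ≤ 0 × T (at (w ∷ U) i)) → T seen ⊎ T w
  first (inj₁ s) = inj₁ s
  first (inj₂ (zero , _ , Uw)) = inj₂ Uw
⇒lollipop (suc M) seen (u ∷ U) chosen near = ⇒lollipop M (seen ∨ u) U (first chosen) near
  where
  first : T seen ⊎ (∃ λ i → i ≤ suc M × T (at (u ∷ U) i)) →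
    T (seen ∨ u) ⊎ (∃ λ i → i ≤ M × T (at U i))
  first (inj₁ s) = inj₁ (T-∨⁺ (inj₁ s))
  first (inj₂ (zero , _ , Uu)) = inj₁ (T-∨⁺ {seen} (inj₂ Uu))
  first (inj₂ (suc i , s≤s i≤M , Ui)) = inj₂ (i , i≤M , Ui)

Dominates⇒Near : ∀ M {n} (U : Subset (suc M + n)) → Dominates (suc M) U →
  ∀ i → i < n → Near U (M + i)
Dominates⇒Near M U dom i i<n with dom (suc M + i) (+-monoʳ-< (suc M) i<n)
... | inj₁ Uv = inj₂ (inj₁ Uv)
... | inj₂ (u , Uu , inj₁ (_ , v<m , _)) = contradiction v<m (m+n≮m (suc M) i)
... | inj₂ (u , Uu , inj₂ (inj₁ (refl , _))) = inj₁ Uu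
... | inj₂ (u , Uu , inj₂ (inj₂ (refl , _))) = inj₂ (inj₂ Uu)

Near⇒Dominates : ∀ M {n} (U : Subset (suc M + n)) →
  (∀ v → v ≤ M → T (at U v) ⊎ ∃ λ u → T (at U u) × Adjacent (suc M) u v) →
  (∀ i → i < n → Near U (M + i)) → Dominates (suc M) U
Near⇒Dominates M U clique near v v<N with v ≤? M
... | yes v≤M = clique v v≤M
... | no v≰M with m≤n⇒∃[o]m+o≡n (≰⇒> v≰M)
...   | i , refl with near i (+-cancelˡ-< (suc M) _ _ v<N)
...     | inj₁ Uu = inj₂ (M + i , Uu , inj₂ (inj₁ (refl , m≤m+n (suc M) i)))
...     | inj₂ (inj₁ Uv) = inj₁ Uv
...     | inj₂ (inj₂ Uu) = inj₂ (2 + (M + i) , Uu , inj₂ (inj₂ (refl , m≤n⇒m≤1+n (m≤m+n (suc M) i))))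

T⇔⇒≡ : ∀ {x y} → (T x → T y) → (T y → T x) → x ≡ y
T⇔⇒≡ {true} {true} _ _ = refl
T⇔⇒≡ {true} {false} f _ = ⊥-elim (f _)
T⇔⇒≡ {false} {true} _ g = ⊥-elim (g _)
T⇔⇒≡ {false} {false} _ _ = refl

-- In a clique of at least two vertices, vertex 0 has no neighbour on the path, so dominating it
-- forces a chosen clique vertex, which in turn dominates the whole clique.
isDominating≡lollipop : ∀ M n →
  isDominating (lollipopAdj (2 + M) n) ≗ lollipop (suc M) false
isDominating≡lollipop M n U = T⇔⇒≡
  (λ dom → to (isDominating⇒Dominates (2 + M) n U dom))
  (λ ok → Dominates⇒isDominating (2 + M) n U (from (lollipop⇒ (suc M) false U ok)))
  where
  to : Dominates (2 + M) U → T (lollipop (suc M) false U)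
  to dom = ⇒lollipop (suc M) false U (inj₂ chosen) (Dominates⇒Near (suc M) U dom)
    where
    chosen : ∃ λ i → i ≤ suc M × T (at U i)
    chosen with dom 0 (s≤s z≤n)
    ... | inj₁ U₀ = 0 , z≤n , U₀
    ... | inj₂ (u , Uu , inj₁ (s≤s u≤1+M , _)) = u , u≤1+M , Uu
    ... | inj₂ (_ , _ , inj₂ (inj₂ (refl , s≤s ())))
  from : (T false ⊎ ∃ λ i → i ≤ suc M × T (at U i)) × (∀ i → i < n → Near U (suc M + i)) →
    Dominates (2 + M) U
  from (inj₂ (i , i≤1+M , Ui) , near) = Near⇒Dominates (suc M) U clique near
    where
    clique : ∀ v → v ≤ suc M → T (at U v) ⊎ ∃ λ u → T (at U u) × Adjacent (2 + M) u v
    clique v v≤1+M with i ≟ v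
    ... | yes refl = inj₁ Ui
    ... | no i≢v = inj₂ (i , Ui , inj₁ (s≤s i≤1+M , s≤s v≤1+M , i≢v))

-- Here vertex 0 may be dominated from the path, so it is scanned as a path vertex behind an
-- unchosen one.
isDominating≡path : ∀ n → isDominating (lollipopAdj 1 n) ≗ path false
isDominating≡path n U = T⇔⇒≡
  (λ dom → Near⇒path false U (to (isDominating⇒Dominates 1 n U dom)))
  (λ ok → Dominates⇒isDominating 1 n U (from (path⇒Near false U ok)))
  where
  to : Dominates 1 U → ∀ i → i < suc n → Near (false ∷ U) i
  to dom (suc i) (s≤s i<n) = Dominates⇒Near 0 U dom i i<n
  to dom zero _ with dom 0 (s≤s z≤n)
  ... | inj₁ U₀ = inj₂ (inj₁ U₀)
  ... | inj₂ (zero , _ , inj₁ (_ , _ , u≢v)) = contradiction refl u≢v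
  ... | inj₂ (suc _ , _ , inj₁ (s≤s () , _))
  ... | inj₂ (_ , Uu , inj₂ (inj₂ (refl , _))) = inj₂ (inj₂ Uu)
  from : (∀ i → i < suc n → Near (false ∷ U) i) → Dominates 1 U
  from near = Near⇒Dominates 0 U clique (λ i i<n → near (suc i) (s≤s i<n))
    where
    clique : ∀ v → v ≤ 0 → T (at U v) ⊎ ∃ λ u → T (at U u) × Adjacent 1 u v
    clique zero _ with near 0 (s≤s z≤n)
    ... | inj₂ (inj₁ U₀) = inj₁ U₀
    ... | inj₂ (inj₂ U₁) = inj₂ (1 , U₁ , inj₂ (inj₂ (refl , ≤-refl)))

-- Transfer to the domination polynomial

domCoeff≡count : ∀ {N} (adj : Adjacency N) {P} → isDominating adj ≗ P → domCoeff adj ≗ count N P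
domCoeff≡count {N} adj dom≗P i =
  trans (length-filter≡count N (isDominating adj) i) (count-cong N dom≗P i)

theorem4p3 : (m n : ℕ) → 1 ≤ m → 1 ≤ n → Unimodal (dominationPoly (lollipopAdj m n))
theorem4p3 (suc zero) n _ _ = Unimodal-resp
  (λ i → sym (domCoeff≡count (lollipopAdj 1 n) (isDominating≡path n) i)) (path-unimodal n)
theorem4p3 (suc (suc M)) (suc n) _ _ = Unimodal-resp
  (λ i → sym (domCoeff≡count (lollipopAdj (2 + M) (suc n)) (isDominating≡lollipop M (suc n)) i))
  (lollipop-unimodal (suc M) n)
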